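{- Let $\alpha,\beta$ be partitions with $|\alpha|=|\beta|$ and let $k\in\mathbb{Z}_{\ge0}$. If $\alpha=\mu_{(k)}$ and $\beta=(\mu')_{(k)}$ for some partition $\mu$, then $X_{\alpha,\beta,k}$ contains exactly one element, and this element has sign $(-1)^{|\mu|}$.
   Context: Partitions are identified with their Young diagrams (English notation; box $(i,j)$ is in row $i$, column $j$). $\mu'$ is the conjugate (transpose) of $\mu$, $\ell(\mu)$ its number of nonzero rows, $|\mu|$ its size, and $\emptyset$ the empty partition. The rank $r(\mu)$ is the greatest integer $k\ge 0$ with $\mu_k\ge k$ (side length of the Durfee square; $r(\emptyset)=0$). The $k$-stabilization $\mu_{(k)}$ is the partition obtained from $\mu$ by adding $k$ rows of length $r(\mu)$ (inserted so that the rows remain weakly decreasing). For partitions $\nu\subseteq\alpha$, a tableau of skew shape $\alpha/\nu$ is a filling of the boxes of $\alpha$ not in $\nu$ with positive integers; it is semistandard if rows weakly increase left to right and columns strictly increase top to bottom. Its content is $(c_1,c_2,\dots)$ with $c_i$ the number of labels equal to $i$. Its reverse reading word is obtained by reading the rows right to left, from top to bottom. A word is lattice if for every $i\ge1$ each initial segment contains at least as many $i$'s as $(i+1)$'s. A Littlewood--Richardson tableau is a semistandard tableau whose reverse reading word is lattice. $\mathrm{LR}(\alpha/\nu,\lambda)$ denotes the set of Littlewood--Richardson tableaux of shape $\alpha/\nu$ and content $\lambda$ (empty if $\nu\not\subseteq\alpha$). For partitions $\alpha,\beta$ with $|\alpha|=|\beta|$ and $k\ge0$, define $$X_{\alpha,\beta}(\lambda,\nu)=\mathrm{LR}(\alpha/\nu,\lambda)\times\mathrm{LR}(\beta/\nu',\lambda),\qquad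 X_{\alpha,\beta,k}=\bigsqcup_{\lambda,\nu:\ \ell(\lambda)\le k}X_{\alpha,\beta}(\lambda,\nu),$$ where $\lambda,\nu$ range over partitions. The sign of $\chi\in X_{\alpha,\beta}(\lambda,\nu)$ is $\operatorname{sgn}(\chi)=(-1)^{|\nu|}$. -}

module Defs where

open import Data.Bool.Base using (if_then_else_)
open import Data.Integer.Base using (ℤ; -1ℤ) renaming (_^_ to _^ℤ_)
open import Data.List.Base
  using (List; []; _∷_; _++_; length; map; filter; take; reverse; replicate; concatMap; applyUpTo)
open import Data.List.Relation.Unary.All as All using (All; []; _∷_)
open import Data.List.Relation.Unary.All.Properties as Allₚ using ()
open import Data.List.Relation.Unary.AllPairs as AllPairs using (AllPairs)
open import Data.List.Relation.Unary.AllPairs.Properties as AllPairsₚ using ()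
open import Data.List.Relation.Unary.Any using (here)
open import Data.List.Relation.Unary.Linked using (Linked)
open import Data.List.Relation.Unary.Linked.Properties as Linkedₚ using ()
open import Data.List.Properties using (filter-some)
open import Data.Nat.Base using (ℕ; zero; suc; _∸_; _≤_; _<_; _≥_; z≤n; s≤s; z<s; pred)
open import Data.Nat.ListAction using (sum)
open import Data.Nat.Properties
  using (_≟_; _≤?_; _<?_; ≤-refl; ≤-trans; m≤n⇒m≤1+n; <⇒≤; m≤n⇒m<n∨m≡n)
open import Data.Product.Base using (_×_)
open import Data.Sum.Base using (inj₁; inj₂)
open import Function.Base using (flip)
open import Relation.Binary.PropositionalEquality using (_≡_; refl)
open import Relation.Nullary using (yes; no; does; contradiction)
open import Relation.Unary using (Decidable)

-- Rows i and columns j of diagrams are indexed from 0 throughout;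
-- labels of tableaux are positive integers.
--
-- Propositional record fields are declared irrelevant, so that equality of
-- partitions (tableaux, ...) is equality of the underlying data.

-- Element number i of a list, with default value d beyond its end.
at : {A : Set} → A → List A → ℕ → A
at d []       _       = d
at d (x ∷ _)  zero    = x
at d (_ ∷ xs) (suc i) = at d xs i

------------------------------------------------------------------------
-- Partitions

record Partition : Set where
  constructor mkPartition
  field
    parts       : List ℕ
    .decreasing : Linked _≥_ parts
    .positive   : All (0 <_) parts

open Partition public using (parts)

ℓ : Partition → ℕ
ℓ μ = length (parts μ)

∣_∣ : Partition → ℕ
∣ μ ∣ = sum (parts μ)

row : Partition → ℕ → ℕ
row μ i = at 0 (parts μ) i

infix 4 _⊆_

_⊆_ : Partition → Partition → Set
ν ⊆ α = ∀ i → row ν i ≤ row α i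

-- Column j of the diagram has one box for each part exceeding j, and
-- there are as many nonempty columns as boxes in the first row.
columnLength : List ℕ → ℕ → ℕ
columnLength xs j = length (filter (j <?_) xs)

columns : List ℕ → List ℕ
columns xs = applyUpTo (columnLength xs) (at 0 xs 0)

length-filter-mono : {P Q : ℕ → Set} (P? : Decidable P) (Q? : Decidable Q) →
  (∀ {x} → P x → Q x) → ∀ xs → length (filter P? xs) ≤ length (filter Q? xs)
length-filter-mono P? Q? P⇒Q []       = z≤n
length-filter-mono P? Q? P⇒Q (x ∷ xs) with ih ← length-filter-mono P? Q? P⇒Q xs | P? x | Q? x
... | yes _ | yes _ = s≤s ih
... | yes p | no ¬q = contradiction (P⇒Q p) ¬q
... | no _  | yes _ = m≤n⇒m≤1+n ih
... | no _  | no _  = ih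

columnLength-antitone : ∀ xs j → columnLength xs (suc j) ≤ columnLength xs j
columnLength-antitone xs j = length-filter-mono (suc j <?_) (j <?_) <⇒≤ xs

columns-positive : ∀ xs → All (0 <_) (columns xs)
columns-positive []         = []
columns-positive xs@(x ∷ _) =
  Allₚ.applyUpTo⁺₁ (columnLength xs) x (λ j<x → filter-some (_ <?_) (here j<x))

conjugate : Partition → Partition
conjugate (mkPartition xs _ _) = mkPartition (columns xs)
  (Linkedₚ.applyUpTo⁺₂ (columnLength xs) (at 0 xs 0) (columnLength-antitone xs))
  (columns-positive xs)

-- The greatest k ≤ n satisfying P, or 0 if there is none.
greatest : {P : ℕ → Set} → Decidable P → ℕ → ℕ
greatest P? zero    = 0
greatest P? (suc n) = if does (P? (suc n)) then suc n else greatest P? n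

greatest-holds : {P : ℕ → Set} (P? : Decidable P) → P 0 → ∀ n → P (greatest P? n)
greatest-holds P? p₀ zero    = p₀
greatest-holds P? p₀ (suc n) with P? (suc n)
... | yes p = p
... | no _  = greatest-holds P? p₀ n

greatest-maximal : {P : ℕ → Set} (P? : Decidable P) →
  ∀ n {k} → P k → k ≤ n → k ≤ greatest P? n
greatest-maximal P? zero    pk k≤n = k≤n
greatest-maximal P? (suc n) pk k≤n with P? (suc n) | m≤n⇒m<n∨m≡n k≤n
... | yes _ | _              = k≤n
... | no _  | inj₁ (s≤s k≤n′) = greatest-maximal P? n pk k≤n′
... | no ¬p | inj₂ refl      = contradiction pk ¬p

-- The k-th row counting from 1 is row number pred k; for k = 0 the
-- condition holds trivially.
rank : Partition → ℕ
rank μ = greatest (λ k → k ≤? row μ (pred k)) (ℓ μ)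

rank-holds : ∀ μ → rank μ ≤ row μ (pred (rank μ))
rank-holds μ = greatest-holds (λ k → k ≤? row μ (pred k)) z≤n (ℓ μ)

rank-maximal : ∀ μ k → k ≤ row μ (pred k) → k ≤ rank μ
rank-maximal μ zero    _ = z≤n
rank-maximal μ (suc i) p =
  greatest-maximal (λ k → k ≤? row μ (pred k)) (ℓ μ) p
    (inside (parts μ) i (≤-trans z<s p))
  where
  inside : ∀ xs i → 0 < at 0 xs i → suc i ≤ length xs
  inside (_ ∷ _)  zero    _ = s≤s z≤n
  inside (_ ∷ xs) (suc i) q = s≤s (inside xs i q)

insertCopies : ℕ → ℕ → List ℕ → List ℕ
insertCopies k r xs = filter (r ≤?_) xs ++ replicate k r ++ filter (_<? r) xs

insertCopies-decreasing : ∀ k r xs → Linked _≥_ xs → Linked _≥_ (insertCopies k r xs)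
insertCopies-decreasing k r xs dec = Linkedₚ.AllPairs⇒Linked
  (AllPairsₚ.++⁺ (AllPairsₚ.filter⁺ (r ≤?_) dec′)
    (AllPairsₚ.++⁺ (replicated k) (AllPairsₚ.filter⁺ (_<? r) dec′)
      (Allₚ.replicate⁺ k (All.map <⇒≤ small)))
    (All.map (λ r≤x → Allₚ.++⁺ (Allₚ.replicate⁺ k r≤x)
                               (All.map (λ y<r → ≤-trans (<⇒≤ y<r) r≤x) small))
             (Allₚ.all-filter (r ≤?_) xs)))
  where
  dec′ : AllPairs _≥_ xs
  dec′ = Linkedₚ.Linked⇒AllPairs (flip ≤-trans) dec

  small : All (_< r) (filter (_<? r) xs)
  small = Allₚ.all-filter (_<? r) xs

  replicated : ∀ k → AllPairs _≥_ (replicate k r)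
  replicated zero    = AllPairs.[]
  replicated (suc k) = Allₚ.replicate⁺ k ≤-refl AllPairs.∷ replicated k

-- Adding rows of length 0 does not change a partition.
addRows : ℕ → ℕ → Partition → Partition
addRows k zero      μ                      = μ
addRows k r@(suc _) (mkPartition xs dec pos) = mkPartition (insertCopies k r xs)
  (insertCopies-decreasing k r xs dec)
  (Allₚ.++⁺ (Allₚ.filter⁺ (r ≤?_) pos)
    (Allₚ.++⁺ (Allₚ.replicate⁺ k z<s) (Allₚ.filter⁺ (_<? r) pos)))

stabilization : Partition → ℕ → Partition
stabilization μ k = addRows k (rank μ) μ

------------------------------------------------------------------------
-- Littlewood–Richardson tableaux

record Box (α ν : Partition) (i j : ℕ) : Set where
  constructor box
  field
    outside : row ν i ≤ j
    within  : j < row α i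

rowLengths : Partition → Partition → List ℕ
rowLengths α ν = applyUpTo (λ i → row α i ∸ row ν i) (ℓ α)

-- A tableau is given by its rows, each listed from left to right; only
-- meaningful for ν ⊆ α, which is required of LR tableaux below.
record Tableau (α ν : Partition) : Set where
  constructor tableau
  field
    rows      : List (List ℕ)
    .shape    : map length rows ≡ rowLengths α ν
    .positive : All (All (0 <_)) rows

open Tableau public using (rows)

-- The label of box (i , j); the default 0 is not used for boxes of α/ν.
label : ∀ {α ν} → Tableau α ν → ℕ → ℕ → ℕ
label {ν = ν} T i j = at 0 (at [] (rows T) i) (j ∸ row ν i)

record Semistandard {α ν : Partition} (T : Tableau α ν) : Set where
  field
    rows-weak      : ∀ {i j j′} → Box α ν i j → Box α ν i j′ →
                     j < j′ → label T i j ≤ label T i j′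
    columns-strict : ∀ {i i′ j} → Box α ν i j → Box α ν i′ j →
                     i < i′ → label T i j < label T i′ j

readingWord : ∀ {α ν} → Tableau α ν → List ℕ
readingWord T = concatMap reverse (rows T)

count : ℕ → List ℕ → ℕ
count a w = length (filter (_≟ a) w)

-- Positive labels are written suc i; cᵢ₊₁ is compared with λᵢ₊₁ = row lam i.
HasContent : ∀ {α ν} → Tableau α ν → Partition → Set
HasContent T lam = ∀ i → count (suc i) (readingWord T) ≡ row lam i

Lattice : List ℕ → Set
Lattice w = ∀ n i → count (suc (suc i)) (take n w) ≤ count (suc i) (take n w)

record LR (α ν lam : Partition) : Set where
  constructor lr
  field
    filling       : Tableau α ν
    .contained    : ν ⊆ α
    .semistandard : Semistandard filling
    .lattice      : Lattice (readingWord filling)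
    .content      : HasContent filling lam

open LR public using (filling)

------------------------------------------------------------------------
-- Pairs of Littlewood–Richardson tableaux

X : (α β lam ν : Partition) → Set
X α β lam ν = LR α ν lam × LR β (conjugate ν) lam

-- The disjoint union of the sets X α β lam ν over all ν and all lam with
-- at most k rows.
record X≤ (α β : Partition) (k : ℕ) : Set where
  constructor element
  field
    lam ν   : Partition
    .bound  : ℓ lam ≤ k
    pair    : X α β lam ν

sgn : ∀ {α β k} → X≤ α β k → ℤ
sgn χ = -1ℤ ^ℤ ∣ X≤.ν χ ∣

{-# OPTIONS --safe #-}
module Submission where

-- Let r be the rank of μ.  Labels are at most ℓ(λ) ≤ k and columns are strict, so every column of
-- α/ν and of β/ν′ has at most k boxes.  The columns j < r of α (of β) are those of μ (of μ′)
-- lengthened by k, so ν contains the first r columns and the first r rows of μ, hence μ.  Conversely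
-- the first r rows of α and of β are those of μ and of μ′, and the other rows of α have length at
-- most r, so ν = μ.  Now α/μ consists of r columns of exactly k boxes, which are forced to be filled
-- with 1, …, k, and likewise β/μ′; both tableaux have content (r, …, r).

open import Defs
open import Data.Integer.Base using (-1ℤ) renaming (_^_ to _^ℤ_)
open import Data.List.Base
  using (List; []; _∷_; _++_; length; map; filter; take; drop; reverse; replicate; concatMap;
         applyUpTo; upTo)
open import Data.List.Properties
  using (filter-++; filter-all; filter-accept; filter-some; length-map; length-applyUpTo;
         filter-reject; filter-none; length-++; unfold-reverse; ≡-dec; length-replicate;
         map-applyUpTo; take-all; take-[]; take++drop≡id; length-upTo)
open import Data.List.Relation.Unary.All as All using (All; []; _∷_)
import Data.List.Relation.Unary.All.Properties as Allₚ
open import Data.List.Membership.Propositional using (_∈_)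
import Data.List.Relation.Unary.Any as Any
import Data.List.Relation.Unary.Any.Properties as Anyₚ
open import Data.List.Relation.Unary.Linked as Linked using (Linked; []; _∷_)
open import Data.Nat.Base using (ℕ; zero; suc; _+_; _∸_; _≤_; _<_; _≥_; z≤n; s≤s; z<s; s<s; pred)
open import Data.Nat.Properties
open import Data.Product.Base using (_×_; _,_; proj₁; proj₂; Σ-syntax; ∃-syntax)
open import Data.Sum.Base using (_⊎_; [_,_]′)
open import Function.Base using (_∘_; id)
open import Relation.Binary.PropositionalEquality
open import Relation.Nullary using (yes; no; ¬_; contradiction; recompute)
open import Relation.Unary using (Decidable)

-- Counting in filtered lists

-- Lets lengths of rows and columns be compared box by box.
below⇒≤ : ∀ {a b} → (∀ {j} → j < a → j < b) → a ≤ b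
below⇒≤ {zero}  _ = z≤n
below⇒≤ {suc _} f = f ≤-refl

length-filter-++ : {A : Set} {P : A → Set} (P? : Decidable P) → ∀ xs ys →
  length (filter P? (xs ++ ys)) ≡ length (filter P? xs) + length (filter P? ys)
length-filter-++ P? xs ys = trans (cong length (filter-++ P? xs ys)) (length-++ (filter P? xs))

length-filter-none : {A : Set} {P : A → Set} (P? : Decidable P) → ∀ {xs} →
  All (λ x → ¬ P x) xs → length (filter P? xs) ≡ 0
length-filter-none P? none = cong length (filter-none P? none)

length-filter-applyUpTo-cong : {A B : Set} {P : A → Set} {Q : B → Set}
  (P? : Decidable P) (Q? : Decidable Q) (f : ℕ → A) (g : ℕ → B) → ∀ n →
  (∀ {t} → t < n → P (f t) → Q (g t)) → (∀ {t} → t < n → Q (g t) → P (f t)) →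
  length (filter P? (applyUpTo f n)) ≡ length (filter Q? (applyUpTo g n))
length-filter-applyUpTo-cong P? Q? f g zero    to from = refl
length-filter-applyUpTo-cong P? Q? f g (suc n) to from
  with ih ← length-filter-applyUpTo-cong P? Q? (f ∘ suc) (g ∘ suc) n (to ∘ s<s) (from ∘ s<s)
     | P? (f 0) | Q? (g 0)
... | yes _ | yes _ = cong suc ih
... | yes p | no ¬q = contradiction (to z<s p) ¬q
... | no ¬p | yes q = contradiction (from z<s q) ¬p
... | no _  | no _  = ih

applyUpTo-++ : {A : Set} (f : ℕ → A) → ∀ m n →
  applyUpTo f (m + n) ≡ applyUpTo f m ++ applyUpTo (f ∘ (m +_)) n
applyUpTo-++ f zero    n = refl
applyUpTo-++ f (suc m) n = cong (f 0 ∷_) (applyUpTo-++ (f ∘ suc) m n)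

-- Used with `m` and `n` the lengths of a row of `μ` and of `α`: a count over all columns below `r`
-- reduces to the boxes of that row of the skew shape.
length-filter-upTo-window : {P : ℕ → Set} (P? : Decidable P) → ∀ {m n r} → m ≤ n → n ≤ r →
  (∀ {j} → j < m → ¬ P j) → (∀ {j} → n ≤ j → j < r → ¬ P j) →
  length (filter P? (upTo r)) ≡ length (filter P? (applyUpTo (m +_) (n ∸ m)))
length-filter-upTo-window {P} P? {m} {n} {r} m≤n n≤r low high = begin
  length (filter P? (upTo r))
    ≡⟨ cong (length ∘ filter P?) (trans (cong upTo (sym (m+[n∸m]≡n n≤r))) (applyUpTo-++ id n (r ∸ n))) ⟩
  length (filter P? (upTo n ++ applyUpTo (n +_) (r ∸ n)))
    ≡⟨ length-filter-++ P? (upTo n) _ ⟩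
  length (filter P? (upTo n)) + length (filter P? (applyUpTo (n +_) (r ∸ n)))
    ≡⟨ cong (length (filter P? (upTo n)) +_) (length-filter-none P? (Allₚ.applyUpTo⁺₁ (n +_) (r ∸ n)
         (λ {t} t<r∸n → high (m≤m+n n t) (subst (n + t <_) (m+[n∸m]≡n n≤r) (+-monoʳ-< n t<r∸n))))) ⟩
  length (filter P? (upTo n)) + 0
    ≡⟨ +-identityʳ _ ⟩
  length (filter P? (upTo n))
    ≡⟨ cong (length ∘ filter P?) (trans (cong upTo (sym (m+[n∸m]≡n m≤n))) (applyUpTo-++ id m (n ∸ m))) ⟩
  length (filter P? (upTo m ++ applyUpTo (m +_) (n ∸ m)))
    ≡⟨ length-filter-++ P? (upTo m) _ ⟩
  length (filter P? (upTo m)) + length (filter P? (applyUpTo (m +_) (n ∸ m)))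
    ≡⟨ cong (_+ length (filter P? (applyUpTo (m +_) (n ∸ m))))
         (length-filter-none P? (Allₚ.applyUpTo⁺₁ id m low)) ⟩
  length (filter P? (applyUpTo (m +_) (n ∸ m))) ∎
  where open ≡-Reasoning

length-filter-⊎ : {A : Set} {P Q R : A → Set} (P? : Decidable P) (Q? : Decidable Q) (R? : Decidable R) →
  (∀ {x} → P x → Q x ⊎ R x) → (∀ {x} → Q x → P x) → (∀ {x} → R x → P x) → (∀ {x} → Q x → ¬ R x) →
  ∀ xs → length (filter P? xs) ≡ length (filter Q? xs) + length (filter R? xs)
length-filter-⊎ P? Q? R? split left right disjoint []       = refl
length-filter-⊎ P? Q? R? split left right disjoint (x ∷ xs)
  with ih ← length-filter-⊎ P? Q? R? split left right disjoint xs | P? x | Q? x | R? x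
... | _     | yes q | yes r = contradiction r (disjoint q)
... | yes _ | yes _ | no _  = cong suc ih
... | yes _ | no _  | yes _ = trans (cong suc ih) (sym (+-suc _ _))
... | yes p | no ¬q | no ¬r = contradiction p ([ ¬q , ¬r ]′ ∘ split)
... | no ¬p | yes q | no _  = contradiction (left q) ¬p
... | no ¬p | no _  | yes r = contradiction (right r) ¬p
... | no _  | no _  | no _  = ih

length-filter-filter : {A : Set} {P Q R : A → Set} (P? : Decidable P) (Q? : Decidable Q) (R? : Decidable R) →
  (∀ {x} → Q x → ¬ R x) → (∀ {x} → ¬ R x → Q x) → ∀ xs →
  length (filter P? xs) ≡ length (filter P? (filter Q? xs)) + length (filter P? (filter R? xs))
length-filter-filter P? Q? R? disjoint cover []       = refl
length-filter-filter P? Q? R? disjoint cover (x ∷ xs)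
  with ih ← length-filter-filter P? Q? R? disjoint cover xs | Q? x | R? x
... | yes q | yes r = contradiction r (disjoint q)
... | no ¬q | no ¬r = contradiction (cover ¬r) ¬q
... | yes _ | no _  with P? x
...   | yes _ = cong suc ih
...   | no _  = ih
length-filter-filter P? Q? R? disjoint cover (x ∷ xs) | no _  | yes _ with P? x
...   | yes _ = trans (cong suc ih) (sym (+-suc _ _))
...   | no _  = ih

count-reverse : ∀ a xs → count a (reverse xs) ≡ count a xs
count-reverse a []       = refl
count-reverse a (x ∷ xs) = begin
  count a (reverse (x ∷ xs))             ≡⟨ cong (count a) (unfold-reverse x xs) ⟩
  count a (reverse xs ++ x ∷ [])         ≡⟨ length-filter-++ (_≟ a) (reverse xs) _ ⟩
  count a (reverse xs) + count a (x ∷ []) ≡⟨ cong (_+ count a (x ∷ [])) (count-reverse a xs) ⟩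
  count a xs + count a (x ∷ [])          ≡⟨ +-comm (count a xs) _ ⟩
  count a (x ∷ []) + count a xs          ≡⟨ sym (length-filter-++ (_≟ a) (x ∷ []) xs) ⟩
  count a (x ∷ xs)                       ∎
  where open ≡-Reasoning

-- Lists accessed by index

at-beyond : {A : Set} (d : A) → ∀ xs {i} → length xs ≤ i → at d xs i ≡ d
at-beyond d []       _         = refl
at-beyond d (x ∷ xs) (s≤s p)   = at-beyond d xs p

at-All : {A : Set} {P : A → Set} {d : A} → ∀ {xs i} → All P xs → i < length xs → P (at d xs i)
at-All {i = zero}  (p ∷ _)  _       = p
at-All {i = suc _} (_ ∷ ps) (s≤s q) = at-All ps q

at-All-default : {A : Set} {P : A → Set} {d : A} → P d → ∀ {xs} → All P xs → ∀ i → P (at d xs i)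
at-All-default pd []       i       = pd
at-All-default pd (p ∷ _)  zero    = p
at-All-default pd (_ ∷ ps) (suc i) = at-All-default pd ps i

-- No bound on `i` is assumed: beyond the end, `f` itself has to agree with the default value.
at-applyUpTo : {A : Set} (d : A) (f : ℕ → A) → ∀ n {i} → (n ≤ i → f i ≡ d) →
  at d (applyUpTo f n) i ≡ f i
at-applyUpTo d f zero            h = sym (h z≤n)
at-applyUpTo d f (suc n) {zero}  h = refl
at-applyUpTo d f (suc n) {suc i} h = at-applyUpTo d (f ∘ suc) n (h ∘ s≤s)

at-map : {A B : Set} (f : A → B) (d : A) → ∀ xs i → at (f d) (map f xs) i ≡ f (at d xs i)
at-map f d []       i       = refl
at-map f d (x ∷ xs) zero    = refl
at-map f d (x ∷ xs) (suc i) = at-map f d xs i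

at-ext : {A : Set} (d : A) → ∀ xs ys → length xs ≡ length ys →
  (∀ {i} → i < length xs → at d xs i ≡ at d ys i) → xs ≡ ys
at-ext d []       []       _  _ = refl
at-ext d (x ∷ xs) (y ∷ ys) eq h =
  cong₂ _∷_ (h z<s) (at-ext d xs ys (suc-injective eq) (h ∘ s<s))

at-nonzero : ∀ xs {i} → 0 < at 0 xs i → i < length xs
at-nonzero (x ∷ xs) {zero}  _ = z<s
at-nonzero (x ∷ xs) {suc i} p = s<s (at-nonzero xs p)

at-decreasing : ∀ {xs} → Linked _≥_ xs → ∀ {i j} → i ≤ j → at 0 xs j ≤ at 0 xs i
at-decreasing {[]}         _         _               = z≤n
at-decreasing {x ∷ xs}     l         {zero}  {zero}  _ = ≤-refl
at-decreasing {x ∷ []}     l         {zero}  {suc j} _ = z≤n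
at-decreasing {x ∷ y ∷ xs} (p ∷ l)   {zero}  {suc j} _ = ≤-trans (at-decreasing l {0} {j} z≤n) p
at-decreasing {x ∷ xs}     l         {suc i} {suc j} (s≤s q) = at-decreasing (Linked.tail l) q

-- Rows, columns and conjugation

-- As the entries decrease, those exceeding `j` form an initial segment, so their number tells at
-- which indices they stand.
columnLength-complete : ∀ {xs} → Linked _≥_ xs → ∀ {i j} → j < at 0 xs i → i < columnLength xs j
columnLength-complete {x ∷ xs} l {i} {j} p = subst (i <_) (sym (cong length (filter-accept (j <?_) j<x))) (bound i p)
  where
  j<x : j < x
  j<x = <-≤-trans p (at-decreasing l {0} {i} z≤n)

  bound : ∀ i → j < at 0 (x ∷ xs) i → i < suc (columnLength xs j)
  bound zero    _ = z<s
  bound (suc i) p = s<s (columnLength-complete (Linked.tail l) p)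

columnLength-sound : ∀ {xs} → Linked _≥_ xs → ∀ {i j} → i < columnLength xs j → j < at 0 xs i
columnLength-sound {x ∷ xs} l {i} {j} p with j <? x
-- Later entries are at most `x`, so none of them can exceed `j` once `x` does not.
... | no j≮x = contradiction
  (<-≤-trans (columnLength-sound (Linked.tail l) {i} (subst (i <_) (cong length (filter-reject (j <?_) j≮x)) p))
             (at-decreasing l {0} {suc i} z≤n)) j≮x
... | yes j<x with i | subst (i <_) (cong length (filter-accept (j <?_) j<x)) p
...   | zero  | _     = j<x
...   | suc _ | s≤s q = columnLength-sound (Linked.tail l) q

column : Partition → ℕ → ℕ
column μ = row (conjugate μ)

-- The field is irrelevant; the property being decidable, `recompute` yields a proof that can be
-- used relevantly.
decreasing : ∀ μ → Linked _≥_ (parts μ)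
decreasing (mkPartition xs dec _) = recompute (Linked.linked? _≥?_ xs) dec

positive : ∀ μ → All (0 <_) (parts μ)
positive (mkPartition xs _ pos) = recompute (All.all? (0 <?_) xs) pos

row-antitone : ∀ μ {i j} → i ≤ j → row μ j ≤ row μ i
row-antitone μ = at-decreasing (decreasing μ)

column≡columnLength : ∀ μ j → column μ j ≡ columnLength (parts μ) j
column≡columnLength μ j = at-applyUpTo 0 (columnLength (parts μ)) (row μ 0) empty
  where
  empty : row μ 0 ≤ j → columnLength (parts μ) j ≡ 0
  empty p with columnLength (parts μ) j in eq
  ... | zero  = refl
  ... | suc n = contradiction
    (columnLength-sound (decreasing μ) {0} (subst (0 <_) (sym eq) z<s)) (≤⇒≯ p)

-- Both inequalities say that the box `(i , j)` lies in the diagram of `μ`.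
<row⇒<column : ∀ μ {i j} → j < row μ i → i < column μ j
<row⇒<column μ p = subst (_ <_) (sym (column≡columnLength μ _)) (columnLength-complete (decreasing μ) p)

<column⇒<row : ∀ μ {i j} → i < column μ j → j < row μ i
<column⇒<row μ p = columnLength-sound (decreasing μ) (subst (_ <_) (column≡columnLength μ _) p)

row≤⇒column≤ : ∀ μ {i j} → row μ i ≤ j → column μ j ≤ i
row≤⇒column≤ μ p = ≮⇒≥ (λ q → ≤⇒≯ p (<column⇒<row μ q))

column≤⇒row≤ : ∀ μ {i j} → column μ j ≤ i → row μ i ≤ j
column≤⇒row≤ μ p = ≮⇒≥ (λ q → ≤⇒≯ p (<row⇒<column μ q))

column-conjugate : ∀ μ i → column (conjugate μ) i ≡ row μ i
column-conjugate μ i = ≤-antisym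
  (below⇒≤ (λ p → <column⇒<row μ (<column⇒<row (conjugate μ) p)))
  (below⇒≤ (λ p → <row⇒<column (conjugate μ) (<row⇒<column μ p)))

parts-injective : ∀ {μ ν} → parts μ ≡ parts ν → μ ≡ ν
parts-injective {mkPartition _ _ _} {mkPartition _ _ _} refl = refl

row-injective : ∀ {μ ν} → (∀ i → row μ i ≡ row ν i) → μ ≡ ν
row-injective {μ} {ν} eq = parts-injective
  (at-ext 0 (parts μ) (parts ν) (≤-antisym (bound μ ν eq) (bound ν μ (sym ∘ eq))) (λ _ → eq _))
  where
  bound : ∀ μ ν → (∀ i → row μ i ≡ row ν i) → ℓ μ ≤ ℓ ν
  bound μ ν eq = below⇒≤ (λ {i} p →
    at-nonzero (parts ν) (subst (0 <_) (eq i) (at-All (positive μ) p)))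

-- The Durfee square

-- A square of side `r` fits into the diagram and the box `(r , r)` is absent. This form passes
-- easily to the conjugate, whereas `rank` is defined by a search.
record HasRank (r : ℕ) (μ : Partition) : Set where
  field
    inner : ∀ {i} → i < r → r ≤ row μ i
    outer : ∀ {i} → r ≤ i → row μ i ≤ r

open HasRank

rank-hasRank : ∀ μ → HasRank (rank μ) μ
rank-hasRank μ .inner {i} i<r = ≤-trans (rank-holds μ) (row-antitone μ (≤-pred-pred i<r))
  where
  ≤-pred-pred : ∀ {i r} → i < r → i ≤ pred r
  ≤-pred-pred (s≤s p) = p
rank-hasRank μ .outer {i} r≤i = ≮⇒≥ λ r<row →
  n≮n (rank μ) (rank-maximal μ (suc (rank μ)) (≤-trans r<row (row-antitone μ r≤i)))

hasRank-conjugate : ∀ {r μ} → HasRank r μ → HasRank r (conjugate μ)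
hasRank-conjugate {r} {μ} h .inner i<r = below⇒≤ λ j<r → <row⇒<column μ (<-≤-trans i<r (inner h j<r))
hasRank-conjugate {r} {μ} h .outer r≤i = row≤⇒column≤ μ (≤-trans (outer h ≤-refl) r≤i)

-- If `s < r`, then row `s` would have at least `r` and at most `s` boxes.
hasRank-≤ : ∀ {r s μ} → HasRank r μ → HasRank s μ → r ≤ s
hasRank-≤ h h′ = ≮⇒≥ λ s<r → <⇒≱ s<r (≤-trans (inner h s<r) (outer h′ ≤-refl))

rank-conjugate : ∀ μ → rank (conjugate μ) ≡ rank μ
rank-conjugate μ = ≤-antisym (hasRank-≤ r′ r) (hasRank-≤ r r′)
  where
  r  = hasRank-conjugate (rank-hasRank μ)
  r′ = rank-hasRank (conjugate μ)

-- Columns of a stabilization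

columnLength-replicate-< : ∀ k {r j} → j < r → columnLength (replicate k r) j ≡ k
columnLength-replicate-< k {r} {j} j<r =
  trans (cong length (filter-all (j <?_) (Allₚ.replicate⁺ k j<r))) (length-replicate k)

columnLength-replicate-≥ : ∀ k {r j} → r ≤ j → columnLength (replicate k r) j ≡ 0
columnLength-replicate-≥ k r≤j = length-filter-none (_ <?_) (Allₚ.replicate⁺ k (≤⇒≯ r≤j))

-- A column length counts parts regardless of their order, so the place of insertion does not
-- matter.
columnLength-insertCopies : ∀ k r xs j →
  columnLength (insertCopies k r xs) j ≡ columnLength xs j + columnLength (replicate k r) j
columnLength-insertCopies k r xs j = begin
  columnLength (big ++ replicate k r ++ small) j
    ≡⟨ length-filter-++ (j <?_) big _ ⟩
  columnLength big j + columnLength (replicate k r ++ small) j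
    ≡⟨ cong (columnLength big j +_) (length-filter-++ (j <?_) (replicate k r) small) ⟩
  columnLength big j + (columnLength (replicate k r) j + columnLength small j)
    ≡⟨ cong (columnLength big j +_) (+-comm (columnLength (replicate k r) j) _) ⟩
  columnLength big j + (columnLength small j + columnLength (replicate k r) j)
    ≡⟨ sym (+-assoc (columnLength big j) _ _) ⟩
  columnLength big j + columnLength small j + columnLength (replicate k r) j
    ≡⟨ cong (_+ columnLength (replicate k r) j) (sym (length-filter-filter (j <?_) (r ≤?_) (_<? r) ≤⇒≯ ≮⇒≥ xs)) ⟩
  columnLength xs j + columnLength (replicate k r) j ∎
  where
  open ≡-Reasoning
  big   = filter (r ≤?_) xs
  small = filter (_<? r) xs

column-addRows : ∀ k r μ j →
  column (addRows k r μ) j ≡ column μ j + columnLength (replicate k r) j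
-- `addRows` leaves `μ` unchanged for rows of length 0, and such rows meet no column.
column-addRows k zero    μ j = sym
  (trans (cong (column μ j +_) (columnLength-replicate-≥ k {0} {j} z≤n)) (+-identityʳ _))
column-addRows k (suc r) μ j = begin
  column (addRows k (suc r) μ) j                            ≡⟨ column≡columnLength (addRows k (suc r) μ) j ⟩
  columnLength (insertCopies k (suc r) (parts μ)) j         ≡⟨ columnLength-insertCopies k (suc r) (parts μ) j ⟩
  columnLength (parts μ) j + columnLength (replicate k (suc r)) j
    ≡⟨ cong (_+ columnLength (replicate k (suc r)) j) (sym (column≡columnLength μ j)) ⟩
  column μ j + columnLength (replicate k (suc r)) j         ∎
  where open ≡-Reasoning

-- The form in which stabilizations enter the argument: each of the first `r` columns gains `k`
-- boxes. Keeping `r` apart from `rank μ` allows `μ` and its conjugate to share it.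
record Stabilizes (k r : ℕ) (μ α : Partition) : Set where
  field
    hasRank     : HasRank r μ
    column-left  : ∀ {j} → j < r → column α j ≡ column μ j + k
    column-right : ∀ {j} → r ≤ j → column α j ≡ column μ j

addRows-stabilizes : ∀ k {r} μ → HasRank r μ → Stabilizes k r μ (addRows k r μ)
addRows-stabilizes k {r} μ h = record
  { hasRank      = h
  ; column-left  = λ {j} j<r → trans (column-addRows k r μ j) (cong (column μ j +_) (columnLength-replicate-< k j<r))
  ; column-right = λ {j} r≤j → trans (column-addRows k r μ j)
      (trans (cong (column μ j +_) (columnLength-replicate-≥ k r≤j)) (+-identityʳ _))
  }

open Stabilizes

-- Rows and labels of tableaux

shape : ∀ {α ν} (T : Tableau α ν) → map length (rows T) ≡ rowLengths α ν
shape {α} {ν} (tableau rows sh _) = recompute (≡-dec _≟_ (map length rows) (rowLengths α ν)) sh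

labels-positive : ∀ {α ν} (T : Tableau α ν) → All (All (0 <_)) (rows T)
labels-positive (tableau rows _ pos) = recompute (All.all? (All.all? (0 <?_)) rows) pos

row-beyond : ∀ μ {i} → ℓ μ ≤ i → row μ i ≡ 0
row-beyond μ = at-beyond 0 (parts μ)

length-row : ∀ {α ν} (T : Tableau α ν) i → length (at [] (rows T) i) ≡ row α i ∸ row ν i
length-row {α} {ν} T i = begin
  length (at [] (rows T) i)         ≡⟨ sym (at-map length [] (rows T) i) ⟩
  at 0 (map length (rows T)) i      ≡⟨ cong (λ xs → at 0 xs i) (shape T) ⟩
  at 0 (rowLengths α ν) i           ≡⟨ at-applyUpTo 0 (λ i → row α i ∸ row ν i) (ℓ α)
                                         (λ p → trans (cong (_∸ row ν i) (row-beyond α p)) (0∸n≡0 (row ν i))) ⟩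
  row α i ∸ row ν i                 ∎
  where open ≡-Reasoning

label-All : ∀ {α ν} {P : ℕ → Set} (T : Tableau α ν) → All (All P) (rows T) →
  ∀ {i j} → Box α ν i j → P (label T i j)
label-All {ν = ν} {P} T all {i} {j} (box out in′) = at-All (at-All-default {P = All P} [] all i)
  (subst (j ∸ row ν i <_) (sym (length-row T i)) (∸-monoˡ-< in′ out))

-- Reduces uniqueness of a filling to its labels, box by box.
rows-ext : ∀ {α ν} (T U : Tableau α ν) →
  (∀ {i j} → Box α ν i j → label T i j ≡ label U i j) → rows T ≡ rows U
rows-ext {α} {ν} T U eq = at-ext [] (rows T) (rows U)
  (trans (number T) (sym (number U)))
  λ {i} _ → at-ext 0 _ _ (trans (length-row T i) (sym (length-row U i)))
    -- Position `t` of row `i` is the box in column `row ν i + t`.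
    λ {t} t<len → subst (λ s → at 0 (at [] (rows T) i) s ≡ at 0 (at [] (rows U) i) s)
      (m+n∸m≡n (row ν i) t)
      (eq (box (m≤m+n (row ν i) t)
        (subst (row ν i + t <_) (m+[n∸m]≡n (inside i t (subst (t <_) (length-row T i) t<len)))
          (+-monoʳ-< (row ν i) (subst (t <_) (length-row T i) t<len)))))
  where
  number : ∀ (T : Tableau α ν) → length (rows T) ≡ ℓ α
  number T = trans (sym (length-map length (rows T)))
    (trans (cong length (shape T)) (length-applyUpTo (λ i → row α i ∸ row ν i) (ℓ α)))

  inside : ∀ i t → t < row α i ∸ row ν i → row ν i ≤ row α i
  inside i t p = <⇒≤ (m∸n≢0⇒n<m (λ eq → n≮0 (subst (t <_) eq p)))

-- A label that occurs has a positive count, so the content has a nonzero part with that index.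
labels-bounded : ∀ {α ν lam} (T : Tableau α ν) → HasContent T lam → All (All (_≤ ℓ lam)) (rows T)
labels-bounded {lam = lam} T content =
  All.map (λ p → All.tabulate (All.lookup p ∘ Anyₚ.reverse⁺))
    (Allₚ.map⁻ (Allₚ.concat⁻ (All.tabulate bounded)))
  where
  bounded : ∀ {x} → x ∈ readingWord T → x ≤ ℓ lam
  bounded {zero}  _ = z≤n
  bounded {suc i} p = at-nonzero (parts lam)
    (subst (0 <_) (content i) (filter-some (_≟ suc i) (Any.map sym p)))

-- Columns of semistandard tableaux with bounded labels

module _ {α ν : Partition} (T : Tableau α ν) (sst : Semistandard T) where
  open Semistandard sst

  column-box : ∀ {i j} → column ν j ≤ i → i < column α j → Box α ν i j
  column-box p q = box (column≤⇒row≤ ν p) (<column⇒<row α q)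

  -- Strict increase down a column gains at least 1 per row.
  label-climbs : ∀ {i j} → column ν j ≤ i → ∀ s → i + s < column α j →
    label T i j + s ≤ label T (i + s) j
  label-climbs {i} {j} p zero    q =
    ≤-reflexive (trans (+-identityʳ _) (cong (λ i → label T i j) (sym (+-identityʳ i))))
  label-climbs {i} {j} p (suc s) q = begin
    label T i j + suc s      ≡⟨ +-suc _ s ⟩
    suc (label T i j + s)    ≤⟨ s≤s (label-climbs p s i+s<col) ⟩
    suc (label T (i + s) j)  ≤⟨ columns-strict (column-box (m≤n⇒m≤n+o s p) i+s<col)
                                  (column-box (m≤n⇒m≤n+o (suc s) p) q) (+-monoʳ-< i ≤-refl) ⟩
    label T (i + suc s) j    ∎
    where
    open ≤-Reasoning
    i+s<col = <-trans (+-monoʳ-< i ≤-refl) q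

  module _ {k} (bounded : All (All (_≤ k)) (rows T)) where

    -- The top label of a column is at least 1, so a box `k` rows further down would carry a label
    -- above `k`.
    column-bound : ∀ j → column α j ≤ column ν j + k
    column-bound j = ≮⇒≥ λ q →
      let c   = column ν j
          top = column-box {c} {j} ≤-refl (≤-<-trans (m≤m+n c k) q)
      in n≮n k (begin-strict
        k                    <⟨ m<n+m k (label-All T (labels-positive T) top) ⟩
        label T c j + k      ≤⟨ label-climbs ≤-refl k q ⟩
        label T (c + k) j    ≤⟨ label-All T bounded (column-box (m≤m+n c k) q) ⟩
        k                    ∎)
      where open ≤-Reasoning

    -- Climbing from the top box gives the lower bound, climbing on to the bottom box the upper one;
    -- in a column of exactly `k` boxes the two meet.
    label-forced : ∀ {i j} → column α j ≡ column ν j + k → Box α ν i j →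
      label T i j ≡ suc (i ∸ column ν j)
    label-forced {i} {j} full b@(box out in′) = ≤-antisym
      (+-cancelʳ-≤ s _ _ (begin
        label T i j + s      ≤⟨ label-climbs c≤i s i+s<col ⟩
        label T (i + s) j    ≤⟨ label-All T bounded (column-box (m≤n⇒m≤n+o s c≤i) i+s<col) ⟩
        k                    ≡⟨ +-cancelˡ-≡ c _ _ (trans (sym full) (trans (sym i+s+1) (trans (sym (+-suc i s))
                                   (trans (cong (_+ suc s) (sym (m+[n∸m]≡n c≤i))) (+-assoc c t (suc s)))))) ⟩
        t + suc s            ≡⟨ +-suc t s ⟩
        suc t + s            ∎))
      (begin
        suc t                ≤⟨ +-monoˡ-≤ t (label-All T (labels-positive T) (column-box ≤-refl (≤-<-trans c≤i i<col))) ⟩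
        label T c j + t      ≤⟨ label-climbs ≤-refl t (subst (_< column α j) (sym (m+[n∸m]≡n c≤i)) i<col) ⟩
        label T (c + t) j    ≡⟨ cong (λ i → label T i j) (m+[n∸m]≡n c≤i) ⟩
        label T i j          ∎)
      where
      open ≤-Reasoning
      c = column ν j
      c≤i = row≤⇒column≤ ν out
      i<col = <row⇒<column α in′
      -- The column has `t` boxes above the given one and `s` below it, whence `k` equals
      -- `t + suc s`.
      t = i ∸ c
      s = column α j ∸ suc i
      i+s+1 : suc (i + s) ≡ column α j
      i+s+1 = m+[n∸m]≡n i<col
      i+s<col : i + s < column α j
      i+s<col = ≤-reflexive i+s+1

-- Rows of a stabilization

module _ {k r : ℕ} {μ α : Partition} (st : Stabilizes k r μ α) where
  open ≤-Reasoning

  stabilizes-⊆ : μ ⊆ α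
  stabilizes-⊆ i = below⇒≤ λ {j} p → <column⇒<row α (<-≤-trans (<row⇒<column μ p) (column≤ j))
    where
    column≤ : ∀ j → column μ j ≤ column α j
    column≤ j with j <? r
    ... | yes j<r = subst (column μ j ≤_) (sym (column-left st j<r)) (m≤m+n _ k)
    ... | no j≮r  = ≤-reflexive (sym (column-right st (≮⇒≥ j≮r)))

  -- Only columns `j < r` grow, and the first `r` rows of `μ` already reach across all of these.
  row-top : ∀ {i} → i < r → row α i ≡ row μ i
  row-top {i} i<r = ≤-antisym (below⇒≤ below) (stabilizes-⊆ i)
    where
    below : ∀ {j} → j < row α i → j < row μ i
    below {j} p with j <? r
    ... | yes j<r = <-≤-trans j<r (inner (hasRank st) i<r)
    ... | no j≮r  = <column⇒<row μ (subst (i <_) (column-right st (≮⇒≥ j≮r)) (<row⇒<column α p))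

  -- Column `r` of `α` is that of `μ`, which has at most `r` boxes, so no row from `r` on reaches
  -- it.
  row-bottom : ∀ {i} → r ≤ i → row α i ≤ r
  row-bottom {i} r≤i = column≤⇒row≤ α (begin
    column α r   ≡⟨ column-right st ≤-refl ⟩
    column μ r   ≤⟨ row≤⇒column≤ μ (outer (hasRank st) ≤-refl) ⟩
    r            ≤⟨ r≤i ⟩
    i            ∎)

  box-left : ∀ {i j} → Box α μ i j → j < r
  box-left {i} {j} (box out in′) = ≰⇒> λ r≤j →
    ≤⇒≯ out (<column⇒<row μ (subst (i <_) (column-right st r≤j) (<row⇒<column α in′)))

  box-rows : ∀ {i j} → Box α μ i j → column μ j ≤ i × i < column μ j + k
  box-rows {i} b@(box out in′) =
    row≤⇒column≤ μ out , subst (i <_) (column-left st (box-left b)) (<row⇒<column α in′)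

  rows-box : ∀ {i j} → j < r → column μ j ≤ i → i < column μ j + k → Box α μ i j
  rows-box {i} j<r p q = box (column≤⇒row≤ μ p) (<column⇒<row α (subst (i <_) (sym (column-left st j<r)) q))

-- Determination of the inner partition

-- The first `r` rows of `ν` are bounded above by those of `α` and below by the column bound for
-- `β`; the first `r` columns likewise, with `α` and `β` exchanged.
filled-unique : ∀ {k r μ α β ν} → Stabilizes k r μ α → Stabilizes k r (conjugate μ) β →
  ν ⊆ α → conjugate ν ⊆ β →
  (∀ j → column α j ≤ column ν j + k) → (∀ i → column β i ≤ column (conjugate ν) i + k) →
  ν ≡ μ
filled-unique {k} {r} {μ} {α} {β} {ν} st st′ ν⊆α ν′⊆β α-bound β-bound = row-injective row≡
  where
  row-top≡ : ∀ {i} → i < r → row ν i ≡ row μ i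
  row-top≡ {i} i<r = ≤-antisym
    (subst (row ν i ≤_) (row-top st i<r) (ν⊆α i))
    (+-cancelʳ-≤ k _ _ (subst₂ (λ a b → a ≤ b + k)
      (trans (column-left st′ i<r) (cong (_+ k) (column-conjugate μ i))) (column-conjugate ν i) (β-bound i)))

  column-left≡ : ∀ {j} → j < r → column ν j ≡ column μ j
  column-left≡ {j} j<r = ≤-antisym
    (subst (column ν j ≤_) (row-top st′ j<r) (ν′⊆β j))
    (+-cancelʳ-≤ k _ _ (subst (_≤ column ν j + k) (column-left st j<r) (α-bound j)))

  row≡ : ∀ i → row ν i ≡ row μ i
  row≡ i with i <? r
  ... | yes i<r = row-top≡ i<r
  ... | no i≮r  = ≤-antisym
    -- The remaining rows of `α` and of `μ` have length at most `r`, so their boxes lie in columns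
    -- where `ν` and `μ` are known to agree.
    (below⇒≤ λ p → <column⇒<row μ (subst (i <_)
      (column-left≡ (<-≤-trans p (≤-trans (ν⊆α i) (row-bottom st r≤i)))) (<row⇒<column ν p)))
    (below⇒≤ λ p → <column⇒<row ν (subst (i <_)
      (sym (column-left≡ (<-≤-trans p (outer (hasRank st) r≤i)))) (<row⇒<column μ p)))
    where r≤i = ≮⇒≥ i≮r

-- Prefixes of the reading word

take-++ : {A : Set} → ∀ n (xs ys : List A) → take n (xs ++ ys) ≡ take n xs ++ take (n ∸ length xs) ys
take-++ zero    []       ys = refl
take-++ zero    (x ∷ xs) ys = refl
take-++ (suc n) []       ys = refl
take-++ (suc n) (x ∷ xs) ys = cong (x ∷_) (take-++ n xs ys)

count-take-≤ : ∀ a n xs → count a (take n xs) ≤ count a xs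
count-take-≤ a n xs = begin
  count a (take n xs)                         ≤⟨ m≤m+n _ _ ⟩
  count a (take n xs) + count a (drop n xs)   ≡⟨ sym (length-filter-++ (_≟ a) (take n xs) (drop n xs)) ⟩
  count a (take n xs ++ drop n xs)            ≡⟨ cong (count a) (take++drop≡id n xs) ⟩
  count a xs                                  ∎
  where open ≤-Reasoning

word : List (List ℕ) → List ℕ
word = concatMap reverse

count-word-take-suc : ∀ a xss i →
  count a (word (take (suc i) xss)) ≡ count a (word (take i xss)) + count a (at [] xss i)
count-word-take-suc a []         zero    = refl
count-word-take-suc a []         (suc i) = refl
count-word-take-suc a (xs ∷ xss) zero    =
  trans (length-filter-++ (_≟ a) (reverse xs) []) (trans (+-identityʳ _) (count-reverse a xs))
count-word-take-suc a (xs ∷ xss) (suc i) = begin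
  count a (reverse xs ++ word (take (suc i) xss))
    ≡⟨ length-filter-++ (_≟ a) (reverse xs) _ ⟩
  count a (reverse xs) + count a (word (take (suc i) xss))
    ≡⟨ cong (count a (reverse xs) +_) (count-word-take-suc a xss i) ⟩
  count a (reverse xs) + (count a (word (take i xss)) + count a (at [] xss i))
    ≡⟨ sym (+-assoc (count a (reverse xs)) _ _) ⟩
  count a (reverse xs) + count a (word (take i xss)) + count a (at [] xss i)
    ≡⟨ cong (_+ count a (at [] xss i)) (sym (length-filter-++ (_≟ a) (reverse xs) _)) ⟩
  count a (reverse xs ++ word (take i xss)) + count a (at [] xss i) ∎
  where open ≡-Reasoning

-- A prefix stops within some row `i` or after the last one. This `i` serves all labels `a` at once,
-- so counts of different labels can be compared by whole rows.
word-prefix-between-rows : ∀ xss n → ∃[ i ] ∀ a →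
  count a (word (take i xss)) ≤ count a (take n (word xss)) ×
  count a (take n (word xss)) ≤ count a (word (take (suc i) xss))
word-prefix-between-rows [] n = 0 , λ a → z≤n , ≤-reflexive (cong (count a) (take-[] n))
word-prefix-between-rows (xs ∷ xss) n with n ≤? length (reverse xs)
... | yes n≤ = 0 , λ a → z≤n , (begin
  count a (take n (reverse xs ++ word xss))
    ≡⟨ cong (count a) (take-++ n (reverse xs) (word xss)) ⟩
  count a (take n (reverse xs) ++ take (n ∸ length (reverse xs)) (word xss))
    ≡⟨ cong (λ m → count a (take n (reverse xs) ++ take m (word xss))) (m≤n⇒m∸n≡0 n≤) ⟩
  count a (take n (reverse xs) ++ [])
    ≡⟨ trans (length-filter-++ (_≟ a) (take n (reverse xs)) []) (+-identityʳ _) ⟩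
  count a (take n (reverse xs))
    ≤⟨ count-take-≤ a n (reverse xs) ⟩
  count a (reverse xs)
    ≡⟨ sym (trans (length-filter-++ (_≟ a) (reverse xs) []) (+-identityʳ _)) ⟩
  count a (reverse xs ++ []) ∎)
  where open ≤-Reasoning
... | no n≰ with i , between ← word-prefix-between-rows xss (n ∸ length (reverse xs)) =
  suc i , λ a →
    subst₂ _≤_ (sym (split a i)) (sym (prefix a)) (+-monoʳ-≤ (count a (reverse xs)) (proj₁ (between a))) ,
    subst₂ _≤_ (sym (prefix a)) (sym (split a (suc i))) (+-monoʳ-≤ (count a (reverse xs)) (proj₂ (between a)))
  where
  split : ∀ a i → count a (reverse xs ++ word (take i xss)) ≡ count a (reverse xs) + count a (word (take i xss))
  split a i = length-filter-++ (_≟ a) (reverse xs) _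

  prefix : ∀ a → count a (take n (reverse xs ++ word xss)) ≡
    count a (reverse xs) + count a (take (n ∸ length (reverse xs)) (word xss))
  prefix a = trans (cong (count a) (trans (take-++ n (reverse xs) (word xss))
      (cong (_++ rest) (take-all n (reverse xs) (≰⇒≥ n≰)))))
    (length-filter-++ (_≟ a) (reverse xs) rest)
    where rest = take (n ∸ length (reverse xs)) (word xss)

-- The rectangular content

-- The common content of both tableaux. Parts must be positive, so for `r = 0` it has to be empty, a
-- case that `addRows` takes care of.
rectangle : ℕ → ℕ → Partition
rectangle k r = addRows k r (mkPartition [] [] [])

row-rectangle-< : ∀ {k i} r → i < k → row (rectangle k r) i ≡ r
row-rectangle-< zero      _   = refl
row-rectangle-< (suc r) i<k = at-replicate i<k
  where
  at-replicate : ∀ {k i} → i < k → at 0 (replicate k (suc r) ++ []) i ≡ suc r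
  at-replicate {suc k} {zero}  _         = refl
  at-replicate {suc k} {suc i} (s≤s i<k) = at-replicate i<k

ℓ-rectangle : ∀ k r → ℓ (rectangle k r) ≤ k
ℓ-rectangle k zero    = z≤n
ℓ-rectangle k (suc r) = ≤-reflexive
  (trans (length-++ (replicate k (suc r))) (trans (+-identityʳ _) (length-replicate k)))

row-rectangle-≥ : ∀ {k i} r → k ≤ i → row (rectangle k r) i ≡ 0
row-rectangle-≥ {k} r k≤i = row-beyond (rectangle k r) (≤-trans (ℓ-rectangle k r) k≤i)

-- The standard filling

module _ (α μ : Partition) where

  -- Here `t` is a position within row `i`, so the box lies in column `row μ i + t`; the labels
  -- number the boxes of each skew column downwards from 1.
  standardLabel : ℕ → ℕ → ℕ
  standardLabel i t = suc (i ∸ column μ (row μ i + t))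

  standardRow : ℕ → List ℕ
  standardRow i = applyUpTo (standardLabel i) (row α i ∸ row μ i)

  standardTableau : Tableau α μ
  standardTableau .rows     = applyUpTo standardRow (ℓ α)
  standardTableau .Tableau.shape    =
    trans (map-applyUpTo standardRow length (ℓ α))
      (applyUpTo-cong (λ i → length-applyUpTo (standardLabel i) (row α i ∸ row μ i)) (ℓ α))
    where
    applyUpTo-cong : {f g : ℕ → ℕ} → (∀ i → f i ≡ g i) → ∀ n → applyUpTo f n ≡ applyUpTo g n
    applyUpTo-cong eq zero    = refl
    applyUpTo-cong eq (suc n) = cong₂ _∷_ (eq 0) (applyUpTo-cong (eq ∘ suc) n)
  standardTableau .Tableau.positive =
    Allₚ.applyUpTo⁺₂ standardRow (ℓ α) (λ i → Allₚ.applyUpTo⁺₂ _ _ (λ t → z<s))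

  at-standard : ∀ i → at [] (rows standardTableau) i ≡ standardRow i
  at-standard i = at-applyUpTo [] standardRow (ℓ α) λ p →
    cong (applyUpTo (standardLabel i)) (trans (cong (_∸ row μ i) (row-beyond α p)) (0∸n≡0 (row μ i)))

  label-standard : ∀ {i j} → Box α μ i j → label standardTableau i j ≡ suc (i ∸ column μ j)
  label-standard {i} {j} (box out in′) = begin
    label standardTableau i j              ≡⟨ cong (λ xs → at 0 xs (j ∸ row μ i)) (at-standard i) ⟩
    at 0 (standardRow i) (j ∸ row μ i)
      ≡⟨ at-applyUpTo 0 (standardLabel i) (row α i ∸ row μ i) (λ p → contradiction p (<⇒≱ (∸-monoˡ-< in′ out))) ⟩
    suc (i ∸ column μ (row μ i + (j ∸ row μ i)))
      ≡⟨ cong (λ j → suc (i ∸ column μ j)) (m+[n∸m]≡n out) ⟩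
    suc (i ∸ column μ j)                   ∎
    where open ≡-Reasoning

  standard-semistandard : Semistandard standardTableau
  standard-semistandard = record
    -- Columns of `μ` shorten to the right, so a box further right lies at least as deep in its skew
    -- column.
    { rows-weak = λ {i} b b′ j<j′ → subst₂ _≤_ (sym (label-standard b)) (sym (label-standard b′))
        (s≤s (∸-monoʳ-≤ i (row-antitone (conjugate μ) (<⇒≤ j<j′))))
    ; columns-strict = λ b b′ i<i′ → subst₂ _<_ (sym (label-standard b)) (sym (label-standard b′))
        (s≤s (∸-monoˡ-< i<i′ (row≤⇒column≤ μ (Box.outside b))))
    }

  module _ {k r : ℕ} (st : Stabilizes k r μ α) where

    row-box : ∀ {i t} → t < row α i ∸ row μ i → Box α μ i (row μ i + t)
    row-box {i} {t} t< = box (m≤m+n _ t)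
      (subst (row μ i + t <_) (m+[n∸m]≡n (stabilizes-⊆ st i)) (+-monoʳ-< (row μ i) t<))

    -- In each of the columns j < r the label suc c sits in row column μ j + c.
    count-standardRow : ∀ {c} → c < k → ∀ i →
      count (suc c) (standardRow i) ≡ length (filter (λ j → column μ j + c ≟ i) (upTo r))
    count-standardRow {c} c<k i with i <? r
    -- Row `i` of the skew shape is empty, and each of the first `r` columns of `μ` has more than
    -- `i` boxes, so both counts vanish.
    ... | yes i<r = trans
      (cong (λ n → count (suc c) (applyUpTo (standardLabel i) n))
        (trans (cong (_∸ row μ i) (row-top st i<r)) (n∸n≡0 (row μ i))))
      (sym (length-filter-none (λ j → column μ j + c ≟ i) (Allₚ.applyUpTo⁺₁ id r λ {j} j<r eq →
        <⇒≱ i<r (≤-trans (inner (hasRank-conjugate (hasRank st)) j<r) (subst (column μ j ≤_) eq (m≤m+n _ c))))))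
    -- Columns left of the window still contain row `i` of `μ`, and columns right of it end in `α`
    -- above row `i`; only the window contributes.
    ... | no i≮r = sym (trans
      (length-filter-upTo-window (λ j → column μ j + c ≟ i) (stabilizes-⊆ st i) (row-bottom st (≮⇒≥ i≮r))
        (λ {j} j<row eq → <⇒≱ (<row⇒<column μ j<row) (subst (column μ j ≤_) eq (m≤m+n _ c)))
        (λ {j} row≤j j<r eq → <⇒≱ (subst (_< column μ j + k) eq (+-monoʳ-< (column μ j) c<k))
          (subst (_≤ i) (column-left st j<r) (row≤⇒column≤ α row≤j))))
      (length-filter-applyUpTo-cong (λ j → column μ j + c ≟ i) (_≟ suc c) (row μ i +_) (standardLabel i) (row α i ∸ row μ i)
        (λ {t} _ eq → cong suc (trans (cong (_∸ column μ (row μ i + t)) (sym eq)) (m+n∸m≡n (column μ (row μ i + t)) c)))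
        (λ {t} t< eq → trans (cong (column μ (row μ i + t) +_) (sym (suc-injective eq)))
          (m+[n∸m]≡n (proj₁ (box-rows st (row-box t<)))))))

    -- A skew column has only `k` boxes, so the depth of a box in it stays below `k`.
    count-standardRow-large : ∀ {c} → k ≤ c → ∀ i → count (suc c) (standardRow i) ≡ 0
    count-standardRow-large {c} k≤c i = length-filter-none (_≟ suc c)
      (Allₚ.applyUpTo⁺₁ (standardLabel i) (row α i ∸ row μ i) λ {t} t< eq →
      let p , q = box-rows st (row-box t<) in
      <⇒≱ (+-cancelˡ-< (column μ (row μ i + t)) _ _ (subst (_< column μ (row μ i + t) + k) (sym (m+[n∸m]≡n p)) q))
          (subst (k ≤_) (sym (suc-injective eq)) k≤c))

    -- By induction: passing from `i` to `suc i` adds the columns whose label `suc c` sits exactly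
    -- in row `i`.
    count-rows : ∀ {c} → c < k → ∀ i →
      count (suc c) (word (take i (rows standardTableau))) ≡ length (filter (λ j → column μ j + c <? i) (upTo r))
    count-rows {c} c<k zero = sym (length-filter-none (λ j → column μ j + c <? 0) (Allₚ.applyUpTo⁺₂ id r λ _ ()))
    count-rows {c} c<k (suc i) = begin
      count (suc c) (word (take (suc i) (rows standardTableau)))
        ≡⟨ count-word-take-suc (suc c) (rows standardTableau) i ⟩
      count (suc c) (word (take i (rows standardTableau))) + count (suc c) (at [] (rows standardTableau) i)
        ≡⟨ cong₂ _+_ (count-rows c<k i) (trans (cong (count (suc c)) (at-standard i)) (count-standardRow c<k i)) ⟩
      length (filter (λ j → column μ j + c <? i) (upTo r)) + length (filter (λ j → column μ j + c ≟ i) (upTo r))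
        ≡⟨ sym (length-filter-⊎ (λ j → column μ j + c <? suc i) (λ j → column μ j + c <? i) (λ j → column μ j + c ≟ i)
             (m≤n⇒m<n∨m≡n ∘ ≤-pred) m<n⇒m<1+n (s≤s ∘ ≤-reflexive) <⇒≢ (upTo r)) ⟩
      length (filter (λ j → column μ j + c <? suc i) (upTo r)) ∎
      where open ≡-Reasoning

    count-rows-large : ∀ {c} → k ≤ c → ∀ i → count (suc c) (word (take i (rows standardTableau))) ≡ 0
    count-rows-large k≤c zero    = refl
    count-rows-large k≤c (suc i) = trans (count-word-take-suc _ (rows standardTableau) i)
      (cong₂ _+_ (count-rows-large k≤c i) (trans (cong (count _) (at-standard i)) (count-standardRow-large k≤c i)))

    -- The labels suc (suc c) in rows ≤ i are as many as the labels suc c in rows < i, so the order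
    -- in which row i is read does not matter.
    standard-lattice : Lattice (readingWord standardTableau)
    standard-lattice n c with i , between ← word-prefix-between-rows (rows standardTableau) n | suc c <? k
    -- Here `suc (suc c)` exceeds `k`, so this label does not occur.
    ... | no c≮k  = ≤-trans (proj₂ (between (suc (suc c))))
      (≤-trans (≤-reflexive (count-rows-large (≮⇒≥ c≮k) (suc i))) z≤n)
    ... | yes c<k = begin
      count (suc (suc c)) (take n (readingWord standardTableau))        ≤⟨ proj₂ (between _) ⟩
      count (suc (suc c)) (word (take (suc i) (rows standardTableau)))  ≡⟨ count-rows c<k (suc i) ⟩
      length (filter (λ j → column μ j + suc c <? suc i) (upTo r))
        ≤⟨ length-filter-mono (λ j → column μ j + suc c <? suc i) (λ j → column μ j + c <? i)
             (λ {j} p → ≤-pred (subst (_< suc i) (+-suc (column μ j) c) p)) (upTo r) ⟩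
      length (filter (λ j → column μ j + c <? i) (upTo r))              ≡⟨ sym (count-rows (<⇒≤ c<k) i) ⟩
      count (suc c) (word (take i (rows standardTableau)))              ≤⟨ proj₁ (between _) ⟩
      count (suc c) (take n (readingWord standardTableau))              ∎
      where open ≤-Reasoning

    standard-content : HasContent standardTableau (rectangle k r)
    standard-content c = trans
      (cong (count (suc c) ∘ word) (sym (take-all (ℓ α) (rows standardTableau)
        (≤-reflexive (length-applyUpTo standardRow (ℓ α))))))
      by-size
      where
      by-size : count (suc c) (word (take (ℓ α) (rows standardTableau))) ≡ row (rectangle k r) c
      by-size with c <? k
      ... | no c≮k  = trans (count-rows-large (≮⇒≥ c≮k) (ℓ α)) (sym (row-rectangle-≥ r (≮⇒≥ c≮k)))
      ... | yes c<k = begin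
        count (suc c) (word (take (ℓ α) (rows standardTableau)))    ≡⟨ count-rows c<k (ℓ α) ⟩
        length (filter (λ j → column μ j + c <? ℓ α) (upTo r))
          -- Each of the `r` skew columns has `k` boxes, more than `c`, and hence contains the label
          -- `suc c` in some row of `α`.
          ≡⟨ cong length (filter-all (λ j → column μ j + c <? ℓ α) (Allₚ.applyUpTo⁺₁ id r λ {j} j<r →
               at-nonzero (parts α) (≤-<-trans z≤n (Box.within
                 (rows-box st j<r (m≤m+n (column μ j) c) (+-monoʳ-< (column μ j) c<k)))))) ⟩
        length (upTo r)                                             ≡⟨ length-upTo r ⟩
        r                                                           ≡⟨ sym (row-rectangle-< r c<k) ⟩
        row (rectangle k r) c                                       ∎
        where open ≡-Reasoning

    standardLR : LR α μ (rectangle k r)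
    standardLR = lr standardTableau (stabilizes-⊆ st) standard-semistandard standard-lattice standard-content

    -- Every box of the skew shape lies in a column `j < r`, and these have exactly `k` boxes, so
    -- `label-forced` applies throughout.
    rows-forced : (T : Tableau α μ) → Semistandard T → All (All (_≤ k)) (rows T) →
      rows T ≡ rows standardTableau
    rows-forced T sst bounded = rows-ext T standardTableau λ b →
      trans (label-forced T sst bounded (column-left st (box-left st b)) b) (sym (label-standard b))

-- Existence and uniqueness of the pair

labels-≤ : ∀ {α ν lam k} (T : Tableau α ν) → HasContent T lam → ℓ lam ≤ k → All (All (_≤ k)) (rows T)
labels-≤ {lam = lam} T content ℓ≤k =
  All.map (All.map (λ p → ≤-trans p ℓ≤k)) (labels-bounded {lam = lam} T content)

-- The content `lam` is still arbitrary: the forced rows will determine it.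
LR-rows-unique : ∀ {k r μ α lam} → Stabilizes k r μ α → .(ℓ lam ≤ k) → (T : LR α μ lam) →
  rows (filling T) ≡ rows (standardTableau α μ)
LR-rows-unique {μ = μ} {α} {lam} st bound (lr T _ sst _ content) =
  recompute (≡-dec (≡-dec _≟_) _ _)
    (rows-forced α μ st T sst (labels-≤ {lam = lam} T content bound))

-- The rows are compared because `T` and `U` have different types until the contents are identified.
LR-content-unique : ∀ {α ν lam lam′} (T : LR α ν lam) (U : LR α ν lam′) →
  rows (filling T) ≡ rows (filling U) → lam ≡ lam′
LR-content-unique {lam = lam} {lam′} (lr T _ _ _ c) (lr U _ _ _ c′) eq =
  parts-injective (recompute (≡-dec _≟_ _ _)
    (cong parts (row-injective {lam} {lam′} (λ i → trans (sym (c i)) (trans (cong (count (suc i) ∘ word) eq) (c′ i))))))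

X≤-ν-unique : ∀ {k r μ α β} → Stabilizes k r μ α → Stabilizes k r (conjugate μ) β →
  (χ : X≤ α β k) → X≤.ν χ ≡ μ
X≤-ν-unique {k} {μ = μ} st st′ (element lam ν bound (lr T ν⊆α sst _ c , lr U ν′⊆β sst′ _ c′)) =
  parts-injective (recompute (≡-dec _≟_ (parts ν) (parts μ)) (cong parts (filled-unique {ν = ν} st st′ ν⊆α ν′⊆β
    (column-bound T sst (labels-≤ {lam = lam} T c bound))
    (column-bound U sst′ (labels-≤ {lam = lam} U c′ bound)))))

-- Everything apart from the rows is irrelevant, so `refl` suffices.
LR-≡ : ∀ {α ν lam} (T U : LR α ν lam) → rows (filling T) ≡ rows (filling U) → T ≡ U
LR-≡ (lr (tableau _ _ _) _ _ _ _) (lr (tableau _ _ _) _ _ _ _) refl = refl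

module _ {k r μ α β} (st : Stabilizes k r μ α) (st′ : Stabilizes k r (conjugate μ) β) where

  standardPair : X≤ α β k
  standardPair = element (rectangle k r) μ (ℓ-rectangle k r) (standardLR α μ st , standardLR β (conjugate μ) st′)

  standardPair-unique : (χ : X≤ α β k) → χ ≡ standardPair
  -- Identifying `ν` with `μ` gives both tableaux the standard shapes; then `T` alone determines the
  -- content, after which whole tableaux can be compared.
  standardPair-unique χ@(element lam ν bound (T , U)) with refl ← X≤-ν-unique st st′ χ
    with refl ← LR-content-unique T (standardLR α μ st) (LR-rows-unique st bound T) =
    cong₂ (λ T U → element lam ν bound (T , U))
      (LR-≡ T (standardLR α μ st) (LR-rows-unique st bound T))
      (LR-≡ U (standardLR β (conjugate μ) st′) (LR-rows-unique st′ bound U))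

theorem4p6 : (α β : Partition) → ∣ α ∣ ≡ ∣ β ∣ → (k : ℕ) →
    (μ : Partition) → α ≡ stabilization μ k → β ≡ stabilization (conjugate μ) k →
    Σ[ χ ∈ X≤ α β k ] ((∀ (χ′ : X≤ α β k) → χ′ ≡ χ) × sgn χ ≡ -1ℤ ^ℤ ∣ μ ∣)
-- The sign is immediate, as the partition `ν` of the standard pair is `μ` itself.
theorem4p6 α β _ k μ refl refl = standardPair st st′ , standardPair-unique st st′ , refl
  where
  st : Stabilizes k (rank μ) μ (stabilization μ k)
  st = addRows-stabilizes k μ (rank-hasRank μ)

  st′ : Stabilizes k (rank μ) (conjugate μ) (stabilization (conjugate μ) k)
  -- The stabilization of the conjugate is formed with its own rank, which is rewritten to `rank μ`
  -- so that both share `r`.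
  st′ = subst (λ r → Stabilizes k r (conjugate μ) (stabilization (conjugate μ) k)) (rank-conjugate μ)
    (addRows-stabilizes k (conjugate μ) (rank-hasRank (conjugate μ)))
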